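{- Let $G$ be a finite simple graph without isolated vertices and let $n\ge 2$ be an integer. Then $\gamma_g(G)=\gamma_{Zg}(G\circ K_n)$, where $K_n$ is the complete graph on $n$ vertices and $\circ$ denotes the lexicographic product.
   Context: Graphs are finite and simple. $N(v)$ and $N[v]=N(v)\cup\{v\}$ denote the open and closed neighborhood of a vertex $v$. The lexicographic product $G\circ H$ has vertex set $V(G)\times V(H)$; vertices $(g_1,h_1)$ and $(g_2,h_2)$ are adjacent if $g_1g_2\in E(G)$, or $g_1=g_2$ and $h_1h_2\in E(H)$. Games: two players, Dominator and Staller, alternately select vertices $v_1,v_2,\ldots$ of an isolate-free graph $G$. In the domination game the $i$-th move $v_i$ is legal if $N[v_i]\setminus\bigcup_{j=1}^{i-1}N[v_j]\neq\emptyset$. In the Z-domination game the $i$-th move $v_i$ is legal if $N(v_i)\setminus\bigcup_{j=1}^{i-1}N[v_j]\neq\emptyset$. Each game ends when no legal move is available. Dominator wants to minimize the total number of moves, Staller wants to maximize it. When Dominator moves first and both players play optimally, the total number of moves played (by both players) is $\gamma_g(G)$ for the domination game and $\gamma_{Zg}(G)$ for the Z-domination game. -}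

module Defs where

open import Level using (0ℓ)
open import Data.Nat using (ℕ; zero; suc; _≤_; _≥_; z≤n; s≤s⁻¹; _*_)
open import Data.Nat.Properties
  using (≤-refl; ≤-trans; ≤-total; ≤-antisym; <-≤-trans)
open import Data.Fin using (Fin)
import Data.Fin as Fin
open import Data.Fin.Properties using (*↔×; any?)
open import Data.List using (List; []; _∷_; length; filter; allFin; map)
open import Data.List.Properties using (filter-notAll)
open import Data.List.Membership.Propositional using (lose) renaming (_∈_ to _∈ₗ_)
open import Data.List.Membership.Propositional.Properties
  using (∈-map⁺; ∈-allFin; ∈-filter⁺)
open import Data.List.Relation.Unary.Any as Any using (Any; here; there)
open import Data.Product using (∃; _×_; _,_; proj₁; proj₂)
open import Data.Product.Function.NonDependent.Propositional using (_×-↔_)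
open import Data.Sum using (_⊎_; inj₁; inj₂)
open import Data.Empty using (⊥-elim)
open import Function using (_∘_; case_of_; _↔_; Inverse)
open import Function.Properties.Inverse using (↔⇒↣; ↔-refl; ↔-sym; ↔-trans)
open import Relation.Binary using (Rel; Irreflexive; Symmetric; DecidableEquality)
import Relation.Binary as B
open import Relation.Binary.PropositionalEquality
  using (_≡_; _≢_; refl; sym; cong; subst; ≢-sym)
open import Relation.Nullary using (¬_; Dec; yes; no; ¬?; _×-dec_; _⊎-dec_)
open import Relation.Nullary.Decidable using (via-injection; map′)
open import Relation.Unary
  using (Pred; Decidable; _∈_; _∉_; _⊆_; _∪_; _∖_; ｛_｝; Satisfiable)

-- Finiteness is an explicit enumeration of the vertices; adjacency is
-- decidable, as it is classically for every finite graph.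
record Graph : Set₁ where
  infix 4 _~_ _~?_ _≟_
  field
    Vertex      : Set
    order       : ℕ
    enumeration : Vertex ↔ Fin order
    _~_         : Rel Vertex 0ℓ
    _~?_        : B.Decidable _~_
    ~-irrefl    : Irreflexive _≡_ _~_
    ~-sym       : Symmetric _~_

  N : Vertex → Pred Vertex 0ℓ
  N v u = v ~ u

  N[_] : Vertex → Pred Vertex 0ℓ
  N[ v ] = N v ∪ ｛ v ｝

  _≟_ : DecidableEquality Vertex
  _≟_ = via-injection (↔⇒↣ enumeration) Fin._≟_

  vertices : List Vertex
  vertices = map (Inverse.from enumeration) (allFin order)

  ∈-vertices : ∀ v → v ∈ₗ vertices
  ∈-vertices v =
    subst (_∈ₗ vertices) (Inverse.strictlyInverseʳ enumeration v)
          (∈-map⁺ (Inverse.from enumeration) (∈-allFin _))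

  N? : ∀ v → Decidable (N v)
  N? v u = v ~? u

  N[_]? : ∀ v → Decidable N[ v ]
  N[ v ]? u = (v ~? u) ⊎-dec (v ≟ u)

  ∃? : {P : Pred Vertex 0ℓ} → Decidable P → Dec (∃ P)
  ∃? {P} P? = map′ (λ (i , p) → Inverse.from enumeration i , p)
    (λ (v , p) → Inverse.to enumeration v
               , subst P (sym (Inverse.strictlyInverseʳ enumeration v)) p)
    (any? (P? ∘ Inverse.from enumeration))

IsolateFree : Graph → Set
IsolateFree G = ∀ v → ∃ λ u → v ~ u
  where open Graph G

K : ℕ → Graph
K n = record
  { Vertex      = Fin n
  ; order       = n
  ; enumeration = ↔-refl
  ; _~_         = _≢_
  ; _~?_        = λ i j → ¬? (i Fin.≟ j)
  ; ~-irrefl    = λ i≡j i≢j → i≢j i≡j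
  ; ~-sym       = ≢-sym
  }

infixr 7 _∘ᴸ_
_∘ᴸ_ : Graph → Graph → Graph
G ∘ᴸ H = record
  { Vertex      = G.Vertex × H.Vertex
  ; order       = G.order * H.order
  ; enumeration = ↔-trans (G.enumeration ×-↔ H.enumeration) (↔-sym (*↔× {G.order} {H.order}))
  ; _~_         = λ (g₁ , h₁) (g₂ , h₂) → g₁ G.~ g₂ ⊎ (g₁ ≡ g₂ × h₁ H.~ h₂)
  ; _~?_        = λ (g₁ , h₁) (g₂ , h₂) →
                    (g₁ G.~? g₂) ⊎-dec ((g₁ G.≟ g₂) ×-dec (h₁ H.~? h₂))
  ; ~-irrefl    = λ where
      refl (inj₁ g~g)       → G.~-irrefl refl g~g
      refl (inj₂ (_ , h~h)) → H.~-irrefl refl h~h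
  ; ~-sym       = λ where
      (inj₁ g₁~g₂)         → inj₁ (G.~-sym g₁~g₂)
      (inj₂ (refl , h₁~h₂)) → inj₂ (refl , H.~-sym h₁~h₂)
  }
  where
  module G = Graph G
  module H = Graph H

data Player : Set where
  Dominator Staller : Player

opponent : Player → Player
opponent Dominator = Staller
opponent Staller   = Dominator

-- Prefers p k l: a game of k further moves is at least as good for p as one of l.
Prefers : Player → Rel ℕ 0ℓ
Prefers Dominator = _≤_
Prefers Staller   = _≥_

Prefers-antisym : ∀ p {k l} → Prefers p k l → Prefers p l k → k ≡ l
Prefers-antisym Dominator k≤l l≤k = ≤-antisym k≤l l≤k
Prefers-antisym Staller   k≥l l≥k = ≤-antisym l≥k k≥l

Prefers-refl : ∀ p {k} → Prefers p k k
Prefers-refl Dominator = ≤-refl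
Prefers-refl Staller   = ≤-refl

Prefers-trans : ∀ p {k l m} → Prefers p k l → Prefers p l m → Prefers p k m
Prefers-trans Dominator k≤l l≤m = ≤-trans k≤l l≤m
Prefers-trans Staller   k≥l l≥m = ≤-trans l≥m k≥l

Prefers-total : ∀ p k l → Prefers p k l ⊎ Prefers p l k
Prefers-total Dominator k l = ≤-total k l
Prefers-total Staller   k l = ≤-total l k

-- The two games differ only in the set F v (N[ v ], respectively N v) that must
-- contain a vertex not dominated so far in order for v to be playable.
module Game (G : Graph) (F : Graph.Vertex G → Pred (Graph.Vertex G) 0ℓ) where
  open Graph G

  Dominated : List Vertex → Pred Vertex 0ℓ
  Dominated played u = Any (λ w → u ∈ N[ w ]) played

  Legal : List Vertex → Pred Vertex 0ℓ
  Legal played v = Satisfiable (F v ∖ Dominated played)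

  -- Value p played k: with the moves in `played` already made (most recent
  -- first) and p to move, optimal play by both players lasts exactly k more
  -- moves.
  data Value (p : Player) (played : List Vertex) : ℕ → Set where
    over : (∀ v → ¬ Legal played v) → Value p played 0
    move : ∀ {k} v → Legal played v → Value (opponent p) (v ∷ played) k →
           (∀ w → Legal played w →
              ∃ λ l → Value (opponent p) (w ∷ played) l × Prefers p k l) →
           Value p played (suc k)

  value-unique : ∀ {p played k l} → Value p played k → Value p played l → k ≡ l
  value-unique (over _)           (over _)           = refl
  value-unique (over end)         (move v legal _ _) = ⊥-elim (end v legal)
  value-unique (move v legal _ _) (over end)         = ⊥-elim (end v legal)
  value-unique {p} (move v v-legal v-val v-best) (move w w-legal w-val w-best)
    with v-best w w-legal | w-best v v-legal
  ... | l , w-val′ , k≼l | k , v-val′ , l≼k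
    with refl ← value-unique w-val′ w-val | refl ← value-unique v-val v-val′
    = cong suc (Prefers-antisym p k≼l l≼k)

  module _ (F? : ∀ v → Decidable (F v)) (F⊆N[] : ∀ v → F v ⊆ N[ v ]) where

    dominated? : ∀ played → Decidable (Dominated played)
    dominated? played u = Any.any? (λ w → N[ w ]? u) played

    legal? : ∀ played → Decidable (Legal played)
    legal? played v = ∃? λ u → F? v u ×-dec ¬? (dominated? played u)

    Best : Player → List Vertex → List Vertex → ℕ → Set
    Best p played vs k =
      ∃ λ v → Legal played v × Value (opponent p) (v ∷ played) k ×
      (∀ w → w ∈ₗ vs → Legal played w →
         ∃ λ l → Value (opponent p) (w ∷ played) l × Prefers p k l)

    best : ∀ p played →
           (∀ v → Legal played v → ∃ (Value (opponent p) (v ∷ played))) →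
           ∀ vs → (∀ v → v ∈ₗ vs → ¬ Legal played v) ⊎ ∃ (Best p played vs)
    best p played val [] = inj₁ λ _ ()
    best p played val (x ∷ xs) with legal? played x | best p played val xs
    ... | no ¬lx | inj₁ none = inj₁ λ where
          _ (here refl) → ¬lx
          v (there v∈)  → none v v∈
    ... | no ¬lx | inj₂ (k , v , lv , vv , vbest) = inj₂ (k , v , lv , vv , λ where
          _ (here refl) lx → ⊥-elim (¬lx lx)
          w (there w∈) lw  → vbest w w∈ lw)
    ... | yes lx | inj₁ none = inj₂ (proj₁ (val x lx) , x , lx , proj₂ (val x lx) , λ where
          _ (here refl) _ → _ , proj₂ (val x lx) , Prefers-refl p
          w (there w∈) lw → ⊥-elim (none w w∈ lw))
    ... | yes lx | inj₂ (k , v , lv , vv , vbest)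
      with val x lx
    ... | l , xv with Prefers-total p k l
    ...   | inj₁ k≼l = inj₂ (k , v , lv , vv , λ where
            _ (here refl) _ → l , xv , k≼l
            w (there w∈) lw → vbest w w∈ lw)
    ...   | inj₂ l≼k = inj₂ (l , x , lx , xv , λ where
            _ (here refl) _ → l , xv , Prefers-refl p
            w (there w∈) lw → let m , wv , k≼m = vbest w w∈ lw
                              in  m , wv , Prefers-trans p l≼k k≼m)

    -- `us` contains every undominated vertex, so its length bounds the
    -- number of remaining moves.
    value-bounded : ∀ b p played us → length us ≤ b →
                    (∀ u → u ∉ Dominated played → u ∈ₗ us) →
                    ∃ (Value p played)
    value-bounded zero p played [] z≤n undom = 0 , over λ where
      v (u , _ , u∉) → case undom u u∉ of λ ()
    value-bounded (suc b) p played us us≤ undom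
      with best p played val vertices
      where
      val : ∀ v → Legal played v → ∃ (Value (opponent p) (v ∷ played))
      val v (u , u∈F , u∉) =
        value-bounded b (opponent p) (v ∷ played) (filter new? us)
          (s≤s⁻¹ (<-≤-trans (filter-notAll new? us
             (lose (undom u u∉) λ ¬dom → ¬dom (here (F⊆N[] v u∈F)))) us≤))
          (λ u′ u′∉ → ∈-filter⁺ new? (undom u′ (u′∉ ∘ there)) u′∉)
        where
        new? : Decidable (λ u′ → u′ ∉ Dominated (v ∷ played))
        new? u′ = ¬? (dominated? (v ∷ played) u′)
    ... | inj₁ none = 0 , over λ v → none v (∈-vertices v)
    ... | inj₂ (k , v , lv , vv , vbest) =
          suc k , move v lv vv λ w → vbest w (∈-vertices w)

    value : ∀ p played → ∃ (Value p played)
    value p played = value-bounded (length vertices) p played vertices ≤-refl λ u _ → ∈-vertices u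

module DominationGame (G : Graph) = Game G (Graph.N[_] G)

module ZDominationGame (G : Graph) = Game G (Graph.N G)

γg-value : ∀ G → ∃ (DominationGame.Value G Dominator [])
γg-value G = DominationGame.value G (Graph.N[_]? G) (λ _ u∈ → u∈) Dominator []

γZg-value : ∀ G → ∃ (ZDominationGame.Value G Dominator [])
γZg-value G = ZDominationGame.value G (Graph.N? G) (λ _ → inj₁) Dominator []

γg : Graph → ℕ
γg G = proj₁ (γg-value G)

γZg : Graph → ℕ
γZg G = proj₁ (γZg-value G)

{-# OPTIONS --safe #-}
module Submission where

-- In G ∘ᴸ K n the closed neighborhood of (g , h) is the preimage of N[ g ] under
-- the projection to G and, as n ≥ 2, its open neighborhood meets every fiber over
-- N[ g ]. Hence a move is legal in the Z-domination game exactly when its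
-- projection is legal in the domination game on G, and the values coincide.

open import Defs
open import Data.Nat using (ℕ; suc; _≤_; s≤s; z≤n)
open import Data.Fin as Fin using (Fin; zero; suc)
open import Data.List using (map)
import Data.List.Relation.Unary.Any as Any
open import Data.List.Relation.Unary.Any.Properties using (map⁺; map⁻)
open import Data.Product using (∃; _,_; proj₁; proj₂)
open import Data.Sum using (inj₁; inj₂)
open import Function using (_∘_)
open import Relation.Binary.PropositionalEquality using (_≡_; _≢_; refl)
open import Relation.Nullary using (yes; no)
open import Relation.Unary using (_∈_)

∃-≢ : ∀ {m} (i : Fin (suc (suc m))) → ∃ λ j → i ≢ j
∃-≢ zero    = suc zero , λ ()
∃-≢ (suc _) = zero , λ ()

module _ (G : Graph) (n : ℕ) where

  private
    module G  = Graph G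
    module GK = Graph (G ∘ᴸ K n)
    module D  = DominationGame G
    module Z  = ZDominationGame (G ∘ᴸ K n)

  N⇒N[proj₁] : ∀ {v u} → u ∈ GK.N v → proj₁ u ∈ G.N[ proj₁ v ]
  N⇒N[proj₁] (inj₁ v~u)       = inj₁ v~u
  N⇒N[proj₁] (inj₂ (v≡u , _)) = inj₂ v≡u

  N[]⇒N[proj₁] : ∀ {v u} → u ∈ GK.N[ v ] → proj₁ u ∈ G.N[ proj₁ v ]
  N[]⇒N[proj₁] (inj₁ u∈N)  = N⇒N[proj₁] u∈N
  N[]⇒N[proj₁] (inj₂ refl) = inj₂ refl

  -- Each fiber of `proj₁` is a copy of a complete graph, so two vertices in the same fiber are
  -- equal or adjacent.
  N[proj₁]⇒N[] : ∀ {v u} → proj₁ u ∈ G.N[ proj₁ v ] → u ∈ GK.N[ v ]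
  N[proj₁]⇒N[] (inj₁ v~u) = inj₁ (inj₁ v~u)
  N[proj₁]⇒N[] {_ , h} {_ , i} (inj₂ refl) with h Fin.≟ i
  ... | yes refl = inj₂ refl
  ... | no  h≢i  = inj₁ (inj₂ (refl , h≢i))

  dominated-proj₁⁺ : ∀ {played u} → Z.Dominated played u →
                     D.Dominated (map proj₁ played) (proj₁ u)
  dominated-proj₁⁺ = map⁺ ∘ Any.map N[]⇒N[proj₁]

  dominated-proj₁⁻ : ∀ {played u} → D.Dominated (map proj₁ played) (proj₁ u) →
                     Z.Dominated played u
  dominated-proj₁⁻ = Any.map N[proj₁]⇒N[] ∘ map⁻

  legal-proj₁⁺ : ∀ {played v} → Z.Legal played v →
                 D.Legal (map proj₁ played) (proj₁ v)
  legal-proj₁⁺ (u , u∈N , u∉) = proj₁ u , N⇒N[proj₁] u∈N , u∉ ∘ dominated-proj₁⁻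

module _ (G : Graph) (m : ℕ) where

  private
    module D = DominationGame G
    module Z = ZDominationGame (G ∘ᴸ K (suc (suc m)))

  legal-proj₁⁻ : ∀ {played v} → D.Legal (map proj₁ played) (proj₁ v) →
                 Z.Legal played v
  legal-proj₁⁻ {v = _ , h} (g , inj₁ v~g , g∉) =
    (g , h) , inj₁ v~g , g∉ ∘ dominated-proj₁⁺ G _
  -- The open neighborhood of `(g , h)` omits `(g , h)` itself, so the witness is another vertex of
  -- its fiber, undominated because `g` is.
  legal-proj₁⁻ {v = _ , h} (g , inj₂ v≡g , g∉) =
    let i , h≢i = ∃-≢ h in (g , i) , inj₂ (v≡g , h≢i) , g∉ ∘ dominated-proj₁⁺ G _

  -- Induction on the derivation of the value: an optimal move lifts to its fiber, and each
  -- competing move in the product is judged by its projection.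
  value-lift : ∀ {p played k} → D.Value p (map proj₁ played) k → Z.Value p played k
  value-lift (D.over end) = Z.over λ v → end (proj₁ v) ∘ legal-proj₁⁺ G _
  value-lift (D.move g legal val best) =
    -- `zero` is an arbitrary choice: legality depends only on the projection.
    Z.move (g , zero) (legal-proj₁⁻ legal) (value-lift val) λ w w-legal →
      let l , w-val , k≼l = best (proj₁ w) (legal-proj₁⁺ G _ w-legal)
      in  l , value-lift w-val , k≼l

proposition3p2 : ∀ (G : Graph) → IsolateFree G → ∀ (n : ℕ) → 2 ≤ n → γg G ≡ γZg (G ∘ᴸ K n)
proposition3p2 G _ (suc (suc m)) (s≤s (s≤s z≤n)) =
  -- The empty history projects to itself, so the optimal value on `G` lifts to the starting
  -- position of the product.
  ZDominationGame.value-unique (G ∘ᴸ K (suc (suc m)))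
    (value-lift G m (proj₂ (γg-value G))) (proj₂ (γZg-value (G ∘ᴸ K (suc (suc m)))))
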